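{- Let $\Pi$ be a partition of $[n]$. Then for all integers $i\ge 1$, \[ \mathrm{Comp}_{n+i}(S_\Pi) = \begin{cases} S_{\Pi^{(i)}}, & \text{if } \delta_n\notin S_\Pi,\\ \langle S_{\Pi^{(i)}},\delta_{n+i}\rangle, & \text{if }\delta_n\in S_\Pi.\end{cases} \]
   Context: $S_n$ is the symmetric group on $[n]=\{1,\dots,n\}$; $\delta_n$ is $i\mapsto n+1-i$. For a partition $\Pi$ of $[n]$, $S_\Pi=\{\pi\in S_n: \pi(B)=B \text{ for all } B\in\Pi\}$. Let $\widehat{\Pi}$ be the coarsest partition of $[n]$ into intervals refining $\Pi$, with blocks $[1]_{\widehat\Pi}\ni 1$ and $[n]_{\widehat\Pi}\ni n$. Define partitions of $[n+1]$: $\widehat\Pi^{1}=\{B+1 : B\in\widehat\Pi,\,1\notin B\}\cup\{([1]_{\widehat\Pi}+1)\cup\{1\}\}$ and $\widehat\Pi^{n+1}=\{B: B\in\widehat\Pi,\, n\notin B\}\cup\{[n]_{\widehat\Pi}\cup\{n+1\}\}$; $\Pi'$ is their coarsest common refinement. Set $\Pi^{(1)}=\Pi'$ and $\Pi^{(i+1)}=(\Pi^{(i)})'$ (a partition of $[n+i+1]$). A permutation $\pi\in S_m$ involves $\tau\in S_n$ ($n\le m$) if there are indices $i_1<\dots<i_n$ with $\pi(i_j)<\pi(i_k)$ iff $\tau(j)<\tau(k)$ for all $j,k$; such $\tau$ is an $n$-pattern of $\pi$. For $S\subseteq S_n$, $\mathrm{Comp}_m(S)$ is the set of $\tau\in S_m$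 all of whose $n$-patterns belong to $S$. -}

module Defs where

open import Data.Nat using (ℕ; zero; suc; _+_)
open import Data.Fin using (Fin; zero; suc; _<_; _≤_)
open import Data.Fin.Permutation using (Permutation′; _⟨$⟩ʳ_; id; flip; _∘ₚ_; _≈_)
open import Data.Product using (_×_; ∃; Σ)
open import Data.Sum using (_⊎_)
open import Function.Bundles using (_⇔_)
open import Relation.Binary.PropositionalEquality using (_≡_)

-- A partition of [n] (here Fin n, 0-indexed) is represented by its
-- "same block" relation.  Partitions of [n] given as an input are
-- represented by a block-labelling (every partition arises this way).
BlockRel : ℕ → Set₁
BlockRel n = Fin n → Fin n → Set

labelRel : ∀ {n} → (Fin n → ℕ) → BlockRel n
labelRel ℓ x y = ℓ x ≡ ℓ y

-- S_Π = { π ∈ S_n : π(B) = B for every block B }, the block B being the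
-- class of a representative a.
SΠ : ∀ {n} → BlockRel n → Permutation′ n → Set
SΠ R π = ∀ a →
  (∀ x → R x a → R (π ⟨$⟩ʳ x) a) ×
  (∀ y → R y a → ∃ λ x → R x a × (π ⟨$⟩ʳ x ≡ y))

Between : ∀ {n} → Fin n → Fin n → Fin n → Set
Between k i j = (i ≤ k × k ≤ j) ⊎ (j ≤ k × k ≤ i)

-- Π̂ : the coarsest interval partition refining Π; i and j are in the same
-- block iff every element between them is in the Π-block of i.
hat : ∀ {n} → BlockRel n → BlockRel n
hat R i j = ∀ k → Between k i j → R k i

shiftL : ∀ {m} → Fin (suc (suc m)) → Fin (suc m)
shiftL zero    = zero
shiftL (suc i) = i

clampTop : ∀ {m} → Fin (suc (suc m)) → Fin (suc m)
clampTop {zero}  _       = zero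
clampTop {suc m} zero    = zero
clampTop {suc m} (suc i) = suc (clampTop i)

-- Π' = coarsest common refinement of Π̂¹ and Π̂ⁿ⁺¹ (partition of [n+1])
prime : ∀ {m} → BlockRel (suc m) → BlockRel (suc (suc m))
prime R x y = hat R (shiftL x) (shiftL y) × hat R (clampTop x) (clampTop y)

iter : ∀ {m} (i : ℕ) → BlockRel (suc m) → BlockRel (suc (i + m))
iter zero    R = R
iter (suc i) R = prime (iter i R)

IsPattern : ∀ {k N} → Permutation′ k → Permutation′ N → Set
IsPattern {k} {N} σ π = Σ (Fin k → Fin N) λ e →
  (∀ j j′ → j < j′ → e j < e j′) ×
  (∀ j j′ → (π ⟨$⟩ʳ e j < π ⟨$⟩ʳ e j′) ⇔ (σ ⟨$⟩ʳ j < σ ⟨$⟩ʳ j′))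

Comp : ∀ {k} N → (Permutation′ k → Set) → Permutation′ N → Set
Comp {k} N S τ = ∀ (σ : Permutation′ k) → IsPattern σ τ → S σ

data Gen {N} (S : Permutation′ N → Set) (g : Permutation′ N) : Permutation′ N → Set where
  base : ∀ {π} → S π → Gen S g π
  gen  : Gen S g g
  one  : Gen S g id
  mul  : ∀ {π ρ} → Gen S g π → Gen S g ρ → Gen S g (π ∘ₚ ρ)
  inv  : ∀ {π} → Gen S g π → Gen S g (flip π)
  ext  : ∀ {π ρ} → π ≈ ρ → Gen S g π → Gen S g ρ

{-# OPTIONS --safe #-}
module Submission where

-- Two positions x < y are in the same block of Π^(i) iff Π has a single block on the
-- interval [x - i, y] clipped to [n]. A pattern moves a position or value down by at most i,
-- so a permutation respecting these intervals has all its patterns in S_Π.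
-- Conversely, let all patterns of τ lie in S_Π, and let z < x < w be positions with τ(z), τ(w)
-- on the same side of τ(x). Two patterns that differ only in keeping z or w give x the same
-- value at adjacent indices, which are therefore in one block; so if x belongs to an
-- inversion and to a non-inversion, then [x - i, x] is in one block. Every point between x
-- and τ(x) belongs to an inversion, so the overlapping intervals join up, unless some point
-- belongs to no non-inversion. In that case every other point belongs to an inversion, and
-- the same argument applies to δτ.

open import Defs
open import Data.Nat using (ℕ; zero; suc; pred; _+_; _∸_; _⊓_; _≤_; _<_; z≤n; s≤s; z<s; s<s)
import Data.Nat.Properties as ℕ
open import Data.Fin using (Fin; zero; suc; toℕ; fromℕ<; inject; opposite; punchIn; punchOut)
import Data.Fin as F
import Data.Fin.Properties as F
open import Data.Fin.Permutation
  using (Permutation′; reverse; _⟨$⟩ʳ_; _⟨$⟩ˡ_; inverseˡ; inverseʳ; flip; _∘ₚ_; remove; punchIn-permute)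
open import Data.Product using (_×_; _,_; ∃; proj₁; proj₂)
open import Data.Sum using (_⊎_; inj₁; inj₂; [_,_]′)
open import Function.Base using (_∘_; id)
open import Function.Bundles using (_⇔_; mk⇔; Equivalence; Injection)
open import Function.Properties.Inverse using (↔⇒↣)
open import Relation.Binary.Definitions using (tri<; tri≈; tri>)
open import Relation.Binary.PropositionalEquality
open import Relation.Nullary using (¬_; Dec; yes; no; contradiction)
open import Relation.Nullary.Decidable using (_×-dec_; _⊎-dec_)

open Equivalence using (to; from)

private
  variable
    k n N : ℕ

-- Increasing maps and reversal.

StrictMono : (Fin n → Fin N) → Set
StrictMono e = ∀ j j′ → j F.< j′ → e j F.< e j′

-- The offset c is there for the induction: the tail of g is again increasing, with its lower bound
-- raised by one.
strictMono-lower : (g : Fin n → ℕ) (c : ℕ) → (∀ j j′ → j F.< j′ → g j < g j′) →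
                   (∀ j → c ≤ g j) → ∀ j → c + toℕ j ≤ g j
strictMono-lower g c mono low zero    = subst (_≤ g zero) (sym (ℕ.+-identityʳ c)) (low zero)
strictMono-lower g c mono low (suc j) = subst (_≤ g (suc j)) (sym (ℕ.+-suc c (toℕ j)))
  (strictMono-lower (g ∘ suc) (suc c) (λ j j′ j<j′ → mono (suc j) (suc j′) (s<s j<j′))
    (λ j → ℕ.≤-<-trans (low zero) (mono zero (suc j) z<s)) j)

index≤ : {e : Fin n → Fin N} → StrictMono e → ∀ j → toℕ j ≤ toℕ (e j)
index≤ {e = e} mono = strictMono-lower (toℕ ∘ e) 0 mono (λ _ → z≤n)

opposite-anti-< : {x y : Fin n} → x F.< y → opposite y F.< opposite x
opposite-anti-< {x = x} {y} x<y = subst₂ _<_ (sym (F.opposite-prop y)) (sym (F.opposite-prop x))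
  (ℕ.∸-monoʳ-< (s<s x<y) (F.toℕ<n y))

opposite-cancel-< : {x y : Fin n} → opposite x F.< opposite y → y F.< x
opposite-cancel-< {x = x} {y} lt =
  subst₂ F._<_ (F.opposite-involutive y) (F.opposite-involutive x) (opposite-anti-< lt)

-- The m - j indices after j need as many places above e j. This is `index≤` for the embedding
-- conjugated by reversal.
≤-index+ : ∀ {i m} {e : Fin (suc m) → Fin (suc (i + m))} → StrictMono e →
           ∀ j → toℕ (e j) ≤ i + toℕ j
≤-index+ {i} {m} {e} mono j = ℕ.+-cancelʳ-≤ (m ∸ toℕ j) _ _ (begin
  E + (m ∸ toℕ j)           ≤⟨ ℕ.+-monoʳ-≤ E mirrored ⟩
  E + (i + m ∸ E)           ≡⟨ ℕ.m+[n∸m]≡n (F.toℕ≤pred[n] (e j)) ⟩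
  i + m                     ≡⟨ cong (i +_) (sym (ℕ.m+[n∸m]≡n (F.toℕ≤pred[n] j))) ⟩
  i + (toℕ j + (m ∸ toℕ j)) ≡⟨ sym (ℕ.+-assoc i (toℕ j) _) ⟩
  i + toℕ j + (m ∸ toℕ j)   ∎)
  where
  open ℕ.≤-Reasoning
  E = toℕ (e j)
  e′ : Fin (suc m) → Fin (suc (i + m))
  e′ = opposite ∘ e ∘ opposite
  mirrored : m ∸ toℕ j ≤ i + m ∸ E
  mirrored = subst₂ _≤_ (F.opposite-prop j)
    (trans (cong (toℕ ∘ opposite ∘ e) (F.opposite-involutive j)) (F.opposite-prop (e j)))
    (index≤ {e = e′} (λ x y x<y → opposite-anti-< (mono _ _ (opposite-anti-< x<y))) (opposite j))

perm-injective : (π : Permutation′ n) {x y : Fin n} → π ⟨$⟩ʳ x ≡ π ⟨$⟩ʳ y → x ≡ y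
perm-injective π = Injection.injective (↔⇒↣ π)

-- Inversions and moved points.

Inversion NonInversion : Permutation′ n → Fin n → Fin n → Set
Inversion π x z =
  (z F.< x × π ⟨$⟩ʳ x F.< π ⟨$⟩ʳ z) ⊎ (x F.< z × π ⟨$⟩ʳ z F.< π ⟨$⟩ʳ x)
NonInversion π x z =
  (z F.< x × π ⟨$⟩ʳ z F.< π ⟨$⟩ʳ x) ⊎ (x F.< z × π ⟨$⟩ʳ x F.< π ⟨$⟩ʳ z)

nonInversion? : (π : Permutation′ n) (x z : Fin n) → Dec (NonInversion π x z)
nonInversion? π x z =
  (z F.<? x ×-dec (π ⟨$⟩ʳ z) F.<? (π ⟨$⟩ʳ x)) ⊎-dec (x F.<? z ×-dec (π ⟨$⟩ʳ x) F.<? (π ⟨$⟩ʳ z))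

inversion-or-non : (π : Permutation′ n) {x z : Fin n} → x ≢ z → Inversion π x z ⊎ NonInversion π x z
inversion-or-non π {x} {z} x≢z with F.<-cmp x z | F.<-cmp (π ⟨$⟩ʳ x) (π ⟨$⟩ʳ z)
... | tri≈ _ x≡z _ | _            = contradiction x≡z x≢z
... | _            | tri≈ _ eq _  = contradiction (perm-injective π eq) x≢z
... | tri< lt _ _  | tri< lt′ _ _ = inj₂ (inj₂ (lt , lt′))
... | tri< lt _ _  | tri> _ _ gt′ = inj₁ (inj₂ (lt , gt′))
... | tri> _ _ gt  | tri< lt′ _ _ = inj₁ (inj₁ (gt , lt′))
... | tri> _ _ gt  | tri> _ _ gt′ = inj₂ (inj₁ (gt , gt′))

inversion-sym : (π : Permutation′ n) {x z : Fin n} → Inversion π x z → Inversion π z x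
inversion-sym π (inj₁ p) = inj₂ p
inversion-sym π (inj₂ p) = inj₁ p

reverse-inversion : (π : Permutation′ n) {x z : Fin n} →
                    Inversion (π ∘ₚ reverse) x z → NonInversion π x z
reverse-inversion π (inj₁ (lt , lt′)) = inj₁ (lt , opposite-cancel-< lt′)
reverse-inversion π (inj₂ (lt , lt′)) = inj₂ (lt , opposite-cancel-< lt′)

-- Otherwise the toℕ (π x) smaller values all come from the toℕ x positions below x.
raised⇒inversion : (π : Permutation′ n) {x : Fin n} → x F.< π ⟨$⟩ʳ x →
                   ∃ λ z → x F.< z × π ⟨$⟩ʳ z F.< π ⟨$⟩ʳ x
raised⇒inversion π {x} x<y with F.any? (λ z → x F.<? z ×-dec (π ⟨$⟩ʳ z) F.<? (π ⟨$⟩ʳ x))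
... | yes found = found
... | no none = contradiction (g-injective gu≡gv) (F.<⇒≢ u<v)
  where
  y = π ⟨$⟩ʳ x
  g : Fin (toℕ y) → Fin _
  g v = π ⟨$⟩ˡ inject v
  πg<y : ∀ v → π ⟨$⟩ʳ g v F.< y
  πg<y v = subst (_< toℕ y) (sym (trans (cong toℕ (inverseʳ π)) (F.toℕ-inject v))) (F.toℕ<n v)
  g<x : ∀ v → g v F.< x
  g<x v with F.<-cmp (g v) x
  ... | tri< lt _ _ = lt
  ... | tri≈ _ eq _ = contradiction (cong (π ⟨$⟩ʳ_) eq) (F.<⇒≢ (πg<y v))
  ... | tri> _ _ gt = contradiction (g v , gt , πg<y v) none
  collision = F.pigeonhole x<y (λ v → fromℕ< (g<x v))
  u = proj₁ collision
  v = proj₁ (proj₂ collision)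
  u<v = proj₁ (proj₂ (proj₂ collision))
  gu≡gv : g u ≡ g v
  gu≡gv = F.toℕ-injective (trans (sym (F.toℕ-fromℕ< (g<x u)))
    (trans (cong toℕ (proj₂ (proj₂ (proj₂ collision)))) (F.toℕ-fromℕ< (g<x v))))
  g-injective : ∀ {u v} → g u ≡ g v → u ≡ v
  g-injective {u} {v} eq = F.toℕ-injective (trans (sym (F.toℕ-inject u))
    (trans (cong toℕ (trans (sym (inverseʳ π)) (trans (cong (π ⟨$⟩ʳ_) eq) (inverseʳ π))))
      (F.toℕ-inject v)))

moved⇒inversion : (π : Permutation′ n) {x : Fin n} → x ≢ π ⟨$⟩ʳ x → ∃ (Inversion π x)
moved⇒inversion π {x} x≢y with F.<-cmp x (π ⟨$⟩ʳ x)
... | tri≈ _ eq _ = contradiction eq x≢y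
... | tri< lt _ _ = let z , p = raised⇒inversion π lt in z , inj₂ p
... | tri> _ _ gt =
  -- If π lowers x, then the inverse raises π x; its inversions are those of π with positions and
  -- values exchanged.
  let v , y<v , lt = raised⇒inversion (flip π) {π ⟨$⟩ʳ x}
                       (subst (π ⟨$⟩ʳ x F.<_) (sym (inverseˡ π)) gt)
  in π ⟨$⟩ˡ v , inj₁ (subst (π ⟨$⟩ˡ v F.<_) (inverseˡ π) lt
                    , subst (π ⟨$⟩ʳ x F.<_) (sym (inverseʳ π)) y<v)

-- Patterns and the deletion of a point.

pattern-reverse : {σ : Permutation′ k} {τ : Permutation′ N} →
                  IsPattern σ τ → IsPattern (σ ∘ₚ reverse) (τ ∘ₚ reverse)
pattern-reverse (e , mono , iff) = e , mono , λ j j′ → mk⇔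
  (opposite-anti-< ∘ to (iff j′ j) ∘ opposite-cancel-<)
  (opposite-anti-< ∘ from (iff j′ j) ∘ opposite-cancel-<)

pattern-trans : {ρ : Permutation′ k} {σ : Permutation′ n} {τ : Permutation′ N} →
                IsPattern ρ σ → IsPattern σ τ → IsPattern ρ τ
pattern-trans (e , mono , iff) (e′ , mono′ , iff′) =
  e′ ∘ e , (λ j j′ → mono′ _ _ ∘ mono j j′) ,
  λ j j′ → mk⇔ (to (iff j j′) ∘ to (iff′ _ _)) (from (iff′ _ _) ∘ from (iff j j′))

pattern-refl : (σ : Permutation′ n) → IsPattern σ σ
pattern-refl σ = id , (λ _ _ → id) , λ _ _ → mk⇔ id id

punchIn-mono-< : (r : Fin (suc n)) → StrictMono (punchIn r)
punchIn-mono-< r j j′ j<j′ = ℕ.≰⇒> λ le → ℕ.<⇒≱ j<j′ (F.punchIn-cancel-≤ r j′ j le)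

punchIn-cancel-< : (r : Fin (suc n)) (j j′ : Fin n) → punchIn r j F.< punchIn r j′ → j F.< j′
punchIn-cancel-< r j j′ lt = ℕ.≰⇒> λ le → ℕ.<⇒≱ lt (F.punchIn-mono-≤ r j′ j le)

punchIn-below : (r : Fin (suc n)) (j : Fin n) → punchIn r j F.< r → toℕ (punchIn r j) ≡ toℕ j
punchIn-below (suc r) zero    _        = refl
punchIn-below (suc r) (suc j) (s≤s lt) = cong suc (punchIn-below r j lt)

punchIn-above : (r : Fin (suc n)) (j : Fin n) → r F.< punchIn r j → toℕ (punchIn r j) ≡ suc (toℕ j)
punchIn-above zero    j       _        = refl
punchIn-above (suc r) (suc j) (s≤s lt) = cong suc (punchIn-above r j lt)

-- The point is given by an equation so that it can be a value τ x, which is only provably in the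
-- range of `punchIn`.
punchIn-below-≡ : {r x : Fin (suc n)} {j : Fin n} → punchIn r j ≡ x → x F.< r → toℕ x ≡ toℕ j
punchIn-below-≡ {r = r} {j = j} refl = punchIn-below r j

punchIn-above-≡ : {r x : Fin (suc n)} {j : Fin n} → punchIn r j ≡ x → r F.< x → toℕ x ≡ suc (toℕ j)
punchIn-above-≡ {r = r} {j = j} refl = punchIn-above r j

punchIn-hit : {r x : Fin (suc n)} → r ≢ x → ∃ λ j → punchIn r j ≡ x
punchIn-hit r≢x = punchOut r≢x , F.punchIn-punchOut r≢x

remove-iff : (τ : Permutation′ (suc n)) (r : Fin (suc n)) (j j′ : Fin n) →
             (τ ⟨$⟩ʳ punchIn r j F.< τ ⟨$⟩ʳ punchIn r j′) ⇔
             (remove r τ ⟨$⟩ʳ j F.< remove r τ ⟨$⟩ʳ j′)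
remove-iff τ r j j′ = mk⇔
  (punchIn-cancel-< (τ ⟨$⟩ʳ r) _ _ ∘ subst₂ F._<_ (punchIn-permute τ r j) (punchIn-permute τ r j′))
  (subst₂ F._<_ (sym (punchIn-permute τ r j)) (sym (punchIn-permute τ r j′)) ∘ punchIn-mono-< (τ ⟨$⟩ʳ r) _ _)

remove-pattern : (τ : Permutation′ (suc n)) (r : Fin (suc n)) → IsPattern (remove r τ) τ
remove-pattern τ r = punchIn r , punchIn-mono-< r , remove-iff τ r

∃-pattern : ∀ i {m} (τ : Permutation′ (suc (i + m))) → ∃ λ (σ : Permutation′ (suc m)) → IsPattern σ τ
∃-pattern zero    τ = τ , pattern-refl τ
∃-pattern (suc i) τ =
  let σ , p = ∃-pattern i (remove zero τ)
  in σ , pattern-trans {ρ = σ} {remove zero τ} {τ} p (remove-pattern τ zero)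

-- Clipping indices to a finite range.

clamp : ∀ m → ℕ → Fin (suc m)
clamp m       zero    = zero
clamp zero    (suc k) = zero
clamp (suc m) (suc k) = suc (clamp m k)

clamp-toℕ : ∀ {m} (x : Fin (suc m)) → clamp m (toℕ x) ≡ x
clamp-toℕ           zero    = refl
clamp-toℕ {suc m}   (suc x) = cong suc (clamp-toℕ x)

clamp-top : ∀ m {k k′} → m ≤ k → m ≤ k′ → clamp m k ≡ clamp m k′
clamp-top zero    {zero}  {zero}   _        _        = refl
clamp-top zero    {zero}  {suc _}  _        _        = refl
clamp-top zero    {suc _} {zero}   _        _        = refl
clamp-top zero    {suc _} {suc _}  _        _        = refl
clamp-top (suc m)                  (s≤s le) (s≤s le′) = cong suc (clamp-top m le le′)

-- Every k beyond m is sent to 0 on both sides: by truncated subtraction on the left, by clipping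
-- and reversal on the right.
clamp-opposite : ∀ m k → clamp m (m ∸ k) ≡ opposite (clamp m k)
clamp-opposite m k = F.toℕ-injective (begin
  toℕ (clamp m (m ∸ k))   ≡⟨ toℕ-clamp m (m ∸ k) ⟩
  (m ∸ k) ⊓ m             ≡⟨ ℕ.m≤n⇒m⊓n≡m (ℕ.m∸n≤m m k) ⟩
  m ∸ k                   ≡⟨ ∸-⊓ m k ⟩
  m ∸ (k ⊓ m)             ≡⟨ cong (m ∸_) (sym (toℕ-clamp m k)) ⟩
  m ∸ toℕ (clamp m k)     ≡⟨ sym (F.opposite-prop (clamp m k)) ⟩
  toℕ (opposite (clamp m k)) ∎)
  where
  open ≡-Reasoning
  toℕ-clamp : ∀ m k → toℕ (clamp m k) ≡ k ⊓ m
  toℕ-clamp m       zero    = refl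
  toℕ-clamp zero    (suc k) = refl
  toℕ-clamp (suc m) (suc k) = cong suc (toℕ-clamp m k)
  ∸-⊓ : ∀ m k → m ∸ k ≡ m ∸ (k ⊓ m)
  ∸-⊓ zero    k       = trans (ℕ.0∸n≡0 k) (sym (ℕ.0∸n≡0 (k ⊓ 0)))
  ∸-⊓ (suc m) zero    = refl
  ∸-⊓ (suc m) (suc k) = ∸-⊓ m k

toℕ-shiftL : ∀ {m} (x : Fin (suc (suc m))) → toℕ (shiftL x) ≡ pred (toℕ x)
toℕ-shiftL zero    = refl
toℕ-shiftL (suc x) = refl

toℕ-clampTop : ∀ {m} (x : Fin (suc (suc m))) → toℕ (clampTop x) ≡ toℕ x ⊓ m
toℕ-clampTop {zero}  x       = sym (ℕ.⊓-zeroʳ (toℕ x))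
toℕ-clampTop {suc m} zero    = refl
toℕ-clampTop {suc m} (suc x) = cong suc (toℕ-clampTop x)

-- Interval description of the iterated partitions.

module Labelled {m : ℕ} (ℓ : Fin (suc m) → ℕ) where

  -- The labelling extended by its last value: intervals then need no clipping at the top,
  -- while clipping at 0 is expressed by bounds of the form k ≤ i + j.
  L : ℕ → ℕ
  L = ℓ ∘ clamp m

  L-toℕ : ∀ x → L (toℕ x) ≡ ℓ x
  L-toℕ x = cong ℓ (clamp-toℕ x)

  L-top : ∀ {k k′} → m ≤ k → m ≤ k′ → L k ≡ L k′
  L-top p q = cong ℓ (clamp-top m p q)

  -- L is constant on the interval [k - i, k + 1].
  Link : ℕ → ℕ → Set
  Link i k = ∀ j → k ≤ i + j → j ≤ suc k → L j ≡ L k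

  -- Vacuous for Y ≤ X, so both directions can be conjoined without deciding which point is lower.
  LinkedUp : ℕ → ℕ → ℕ → Set
  LinkedUp i X Y = ∀ k → X ≤ k → k < Y → Link i k

  -- The explicit form of the relation Π^(i), for i ≥ 1.
  Linked : ℕ → Fin N → Fin N → Set
  Linked i x y = LinkedUp i (toℕ x) (toℕ y) × LinkedUp i (toℕ y) (toℕ x)

  linkedUp-trans : ∀ {i X Y} Z → LinkedUp i X Z → LinkedUp i Z Y → LinkedUp i X Y
  linkedUp-trans Z XZ ZY k X≤k k<Y with k ℕ.<? Z
  ... | yes k<Z = XZ k X≤k k<Z
  ... | no  k≮Z = ZY k (ℕ.≮⇒≥ k≮Z) k<Y

  linked-refl : ∀ {i} (x : Fin N) → Linked i x x
  linked-refl x = (λ k x≤k k<x → contradiction k<x (ℕ.≤⇒≯ x≤k))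
                , (λ k x≤k k<x → contradiction k<x (ℕ.≤⇒≯ x≤k))

  linked-sym : ∀ {i} {x y : Fin N} → Linked i x y → Linked i y x
  linked-sym (p , q) = q , p

  linked-trans : ∀ {i} {x y z : Fin N} → Linked i x y → Linked i y z → Linked i x z
  linked-trans {y = y} (p , q) (r , s) = linkedUp-trans (toℕ y) p r , linkedUp-trans (toℕ y) s q

  -- The windows [k - i, k + 1] for X ≤ k < Y overlap and cover [X - i, Y]. The first one handles
  -- the part up to X; the rest is climbed one step at a time.
  linkedUp-const : ∀ {i X Y} → LinkedUp i X Y → X < Y → ∀ {j} → X ≤ i + j → j ≤ Y → L j ≡ L X
  linkedUp-const {i} {X} {Y} linked X<Y {j} X≤i+j j≤Y with ℕ.≤-total j X
  ... | inj₁ j≤X = linked X ℕ.≤-refl X<Y j X≤i+j (ℕ.m≤n⇒m≤1+n j≤X)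
  ... | inj₂ X≤j = climb j X≤j j≤Y
    where
    climb : ∀ j → X ≤ j → j ≤ Y → L j ≡ L X
    climb j X≤j j≤Y with ℕ.m≤n⇒m<n∨m≡n X≤j
    ... | inj₂ refl = refl
    climb (suc j) X≤j j<Y | inj₁ (s≤s X≤j′) = trans
      (linked j X≤j′ j<Y (suc j) (ℕ.≤-trans (ℕ.n≤1+n j) (ℕ.m≤n+m (suc j) i)) ℕ.≤-refl)
      (climb j X≤j′ (ℕ.<⇒≤ j<Y))

  -- The whole window lies at or beyond m, where L is constant.
  link-top : ∀ {i k} → i + m ≤ k → Link i k
  link-top {i} i+m≤k j k≤i+j _ =
    L-top (ℕ.+-cancelˡ-≤ i m j (ℕ.≤-trans i+m≤k k≤i+j)) (ℕ.≤-trans (ℕ.m≤n+m m i) i+m≤k)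

  link-weaken : ∀ {i k} → Link (suc i) k → Link i k
  link-weaken link j k≤ = link j (ℕ.m≤n⇒m≤1+n k≤)

  -- The window [k - i, k + 2] contains [k - i, k + 1].
  link-pred : ∀ {i k} → Link (suc i) (suc k) → Link i k
  link-pred {i} {k} link j k≤ j≤ = trans
    (link j (s≤s k≤) (ℕ.m≤n⇒m≤1+n j≤))
    (sym (link k (s≤s (ℕ.m≤n+m k i)) (ℕ.≤-trans (ℕ.n≤1+n k) (ℕ.n≤1+n (suc k)))))

  link-zero : ∀ {i} → Link i 0 → Link (suc i) 0
  link-zero link j _ = link j z≤n

  -- The windows [k - i, k + 1] and [k + 1 - i, k + 2] meet in k + 1, and their union is
  -- [k - i, k + 2].
  link-suc : ∀ {i k} → Link i k → Link i (suc k) → Link (suc i) (suc k)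
  link-suc {i} {k} link link′ j (s≤s k≤) j≤ with suc k ℕ.≤? i + j
  ... | yes le = link′ j le j≤
  ... | no ¬le = trans (link j k≤ (ℕ.≤-trans (ℕ.m≤n+m j i) (ℕ.m≤n⇒m≤1+n (ℕ.≮⇒≥ ¬le))))
      (sym (link (suc k) (ℕ.≤-trans (ℕ.n≤1+n k) (ℕ.m≤n+m (suc k) i)) ℕ.≤-refl))

  linkedUp-pred : ∀ {i X Y} → LinkedUp (suc i) X Y → LinkedUp i (pred X) (pred Y)
  linkedUp-pred {X = X} {suc Y} linked k X≤k k<Y =
    link-pred (linked (suc k) (unpred X X≤k) (s≤s k<Y))
    where
    unpred : ∀ X → pred X ≤ k → X ≤ suc k
    unpred zero    _  = z≤n
    unpred (suc X) le = s≤s le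

  linkedUp-⊓ : ∀ {i X Y} t → LinkedUp (suc i) X Y → LinkedUp i (X ⊓ t) (Y ⊓ t)
  linkedUp-⊓ {X = X} {Y} t linked k X⊓t≤k k<Y⊓t = link-weaken (linked k X≤k (ℕ.m<n⊓o⇒m<n Y t k<Y⊓t))
    where
    X≤k : X ≤ k
    X≤k with ℕ.⊓-sel X t
    ... | inj₁ eq = subst (_≤ k) eq X⊓t≤k
    ... | inj₂ eq = contradiction (subst (_≤ k) eq X⊓t≤k) (ℕ.<⇒≱ (ℕ.m<n⊓o⇒m<o Y t k<Y⊓t))

  -- The second hypothesis gives the window of k, the first that of k - 1, and `link-suc` glues
  -- them. Cutting at i + m loses nothing, since from there on `link-top` applies.
  linkedUp-join : ∀ {i X Y} → LinkedUp i (pred X) (pred Y) → LinkedUp i (X ⊓ (i + m)) (Y ⊓ (i + m)) →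
                  LinkedUp (suc i) X Y
  linkedUp-join {i} {X} {Y} low high k X≤k k<Y = extend k X≤k k<Y (unclamped k X≤k k<Y)
    where
    unclamped : LinkedUp i X Y
    unclamped k X≤k k<Y with k ℕ.<? i + m
    ... | yes k<t = high k (ℕ.≤-trans (ℕ.m⊓n≤m X _) X≤k) (ℕ.⊓-glb k<Y k<t)
    ... | no  k≮t = link-top (ℕ.≮⇒≥ k≮t)
    extend : ∀ k → X ≤ k → k < Y → Link i k → Link (suc i) k
    extend zero    _   _         link = link-zero link
    extend (suc k) X≤k (s≤s k<Y) link = link-suc (low k (ℕ.pred-mono-≤ X≤k) k<Y) link

  -- The blocks of `Linked` are intervals already, so `hat` leaves them unchanged.
  hat⇔linked : ∀ {i} {R : BlockRel N} → (∀ x y → R x y ⇔ Linked i x y) →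
               ∀ x y → hat R x y ⇔ Linked i x y
  hat⇔linked {i = i} {R} R⇔ x y = mk⇔
    (λ h → linked-sym {x = y} {x} (to (R⇔ y x) (h y between-end)))
    (λ linked z btw → from (R⇔ z x) (restrict linked z btw))
    where
    between-end : Between y x y
    between-end with ℕ.≤-total (toℕ x) (toℕ y)
    ... | inj₁ x≤y = inj₁ (x≤y , ℕ.≤-refl)
    ... | inj₂ y≤x = inj₂ (ℕ.≤-refl , y≤x)
    restrict : Linked i x y → ∀ z → Between z x y → Linked i z x
    restrict (up , down) z (inj₁ (x≤z , z≤y)) =
      (λ k z≤k k<x → contradiction (ℕ.≤-<-trans z≤k k<x) (ℕ.≤⇒≯ x≤z)) ,
      (λ k x≤k k<z → up k x≤k (ℕ.<-≤-trans k<z z≤y))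
    restrict (up , down) z (inj₂ (y≤z , z≤x)) =
      (λ k z≤k k<x → down k (ℕ.≤-trans y≤z z≤k) k<x) ,
      (λ k x≤k k<z → contradiction (ℕ.≤-<-trans x≤k k<z) (ℕ.≤⇒≯ z≤x))

  -- For i = 0 a link compares only the labels of k and k + 1, so a chain of links says that the
  -- label is constant between x and y.
  hat-label⇔linked : ∀ x y → hat (labelRel ℓ) x y ⇔ Linked 0 x y
  hat-label⇔linked x y = mk⇔ forward backward
    where
    const⇒linkedUp : ∀ {X Y c} → (∀ k → X ≤ k → k ≤ Y → L k ≡ c) → LinkedUp 0 X Y
    const⇒linkedUp const k X≤k k<Y j k≤j j≤1+k = trans
      (const j (ℕ.≤-trans X≤k k≤j) (ℕ.≤-trans j≤1+k k<Y)) (sym (const k X≤k (ℕ.<⇒≤ k<Y)))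

    onℕ : hat (labelRel ℓ) x y → ∀ k {b : Fin (suc m)} → k ≤ toℕ b →
          (∀ z → toℕ z ≡ k → Between z x y) → L k ≡ ℓ x
    onℕ h k {b} k≤b btw = trans (cong L (sym eq)) (trans (L-toℕ z) (h z (btw z eq)))
      where
      k<1+m = ℕ.≤-<-trans k≤b (F.toℕ<n b)
      z = fromℕ< k<1+m
      eq = F.toℕ-fromℕ< k<1+m

    forward : hat (labelRel ℓ) x y → Linked 0 x y
    forward h =
      const⇒linkedUp (λ k x≤k k≤y → onℕ h k {y} k≤y λ z eq →
        inj₁ (subst (toℕ x ≤_) (sym eq) x≤k , subst (_≤ toℕ y) (sym eq) k≤y)) ,
      const⇒linkedUp (λ k y≤k k≤x → onℕ h k {x} k≤x λ z eq →
        inj₂ (subst (toℕ y ≤_) (sym eq) y≤k , subst (_≤ toℕ x) (sym eq) k≤x))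

    value : ∀ {X Y} → LinkedUp 0 X Y → ∀ {j} → X ≤ j → j ≤ Y → L j ≡ L X
    value {X} up X≤j j≤Y with ℕ.m≤n⇒m<n∨m≡n (ℕ.≤-trans X≤j j≤Y)
    ... | inj₁ X<Y  = linkedUp-const up X<Y X≤j j≤Y
    ... | inj₂ refl = cong L (ℕ.≤-antisym j≤Y X≤j)

    backward : Linked 0 x y → hat (labelRel ℓ) x y
    backward (up , down) z (inj₁ (x≤z , z≤y)) =
      trans (sym (L-toℕ z)) (trans (value up x≤z z≤y) (L-toℕ x))
    backward (up , down) z (inj₂ (y≤z , z≤x)) = trans (sym (L-toℕ z)) (trans (value down y≤z z≤x)
      (trans (sym (value down (ℕ.≤-trans y≤z z≤x) ℕ.≤-refl)) (L-toℕ x)))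

  -- Assuming the description for `hat R` instead of R lets one lemma serve the first step, where R
  -- is the labelling and its blocks need not be intervals, and all later ones.
  prime⇔linked : ∀ {i} {R : BlockRel (suc (i + m))} → (∀ x y → hat R x y ⇔ Linked i x y) →
                 ∀ x y → prime R x y ⇔ Linked (suc i) x y
  prime⇔linked {i} hat⇔ x y = mk⇔
    (λ (p , q) →
      let up , down = to (hat⇔ _ _) p
          up′ , down′ = to (hat⇔ _ _) q
      in linkedUp-join (subst₂ (LinkedUp i) (toℕ-shiftL x) (toℕ-shiftL y) up)
                       (subst₂ (LinkedUp i) (toℕ-clampTop x) (toℕ-clampTop y) up′)
       , linkedUp-join (subst₂ (LinkedUp i) (toℕ-shiftL y) (toℕ-shiftL x) down)
                       (subst₂ (LinkedUp i) (toℕ-clampTop y) (toℕ-clampTop x) down′))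
    (λ (up , down) →
      from (hat⇔ _ _)
        ( subst₂ (LinkedUp i) (sym (toℕ-shiftL x)) (sym (toℕ-shiftL y)) (linkedUp-pred up)
        , subst₂ (LinkedUp i) (sym (toℕ-shiftL y)) (sym (toℕ-shiftL x)) (linkedUp-pred down)) ,
      from (hat⇔ _ _)
        ( subst₂ (LinkedUp i) (sym (toℕ-clampTop x)) (sym (toℕ-clampTop y)) (linkedUp-⊓ (i + m) up)
        , subst₂ (LinkedUp i) (sym (toℕ-clampTop y)) (sym (toℕ-clampTop x)) (linkedUp-⊓ (i + m) down)))

  iter⇔linked : ∀ i (x y : Fin (suc (suc i + m))) → iter (suc i) (labelRel ℓ) x y ⇔ Linked (suc i) x y
  iter⇔linked zero    = prime⇔linked hat-label⇔linked
  iter⇔linked (suc i) = prime⇔linked (hat⇔linked (iter⇔linked i))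

  -- Block-preserving permutations and their patterns.

  Preserves : ∀ i → Permutation′ N → Set
  Preserves i τ = ∀ x → Linked i x (τ ⟨$⟩ʳ x)

  iter-SΠ⇔preserves : ∀ i (τ : Permutation′ (suc (suc i + m))) →
                      SΠ (iter (suc i) (labelRel ℓ)) τ ⇔ Preserves (suc i) τ
  iter-SΠ⇔preserves i τ = mk⇔
    (λ s x → linked-sym {x = τ ⟨$⟩ʳ x} {x} (to (iter⇔ _ _) (proj₁ (s x) x (from (iter⇔ _ _) (linked-refl x)))))
    (λ s a →
      (λ x r → from (iter⇔ _ _) (linked-trans {x = τ ⟨$⟩ʳ x} {x} {a}
                 (linked-sym {x = x} {τ ⟨$⟩ʳ x} (s x)) (to (iter⇔ _ _) r))) ,
      (λ y r → τ ⟨$⟩ˡ y , from (iter⇔ _ _) (linked-trans {x = τ ⟨$⟩ˡ y} {y} {a}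
                 (subst (Linked (suc i) (τ ⟨$⟩ˡ y)) (inverseʳ τ) (s (τ ⟨$⟩ˡ y))) (to (iter⇔ _ _) r)) , inverseʳ τ))
    where iter⇔ = iter⇔linked i

  label-SΠ⇔ : ∀ σ → SΠ (labelRel ℓ) σ ⇔ (∀ j → ℓ (σ ⟨$⟩ʳ j) ≡ ℓ j)
  label-SΠ⇔ σ = mk⇔
    (λ s j → proj₁ (s j) j refl)
    (λ s a → (λ x eq → trans (s x) eq) ,
             (λ y eq → σ ⟨$⟩ˡ y , trans (sym (s (σ ⟨$⟩ˡ y))) (trans (cong ℓ (inverseʳ σ)) eq) , inverseʳ σ))

  -- An index j of a pattern lies in [e j - i, e j], and likewise for values. If j and σ j
  -- differ then σ has an inversion at j, hence so does τ at e j, and an inverted pair of τ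
  -- contains an element moved across the whole range in question.
  preserves⇒Comp : ∀ {i} (τ : Permutation′ (suc (i + m))) → Preserves i τ →
                   Comp (suc (i + m)) (SΠ (labelRel ℓ)) τ
  preserves⇒Comp {i} τ pres σ (e , mono , iff) = from (label-SΠ⇔ σ) λ j →
    trans (sym (L-toℕ (σ ⟨$⟩ʳ j))) (trans (sameLabel j) (L-toℕ j))
    where
    -- The values of the occurrence in increasing order form a second embedding, to which the same
    -- index bounds apply.
    values : Fin (suc m) → Fin (suc (i + m))
    values v = τ ⟨$⟩ʳ e (σ ⟨$⟩ˡ v)
    values-mono : StrictMono values
    values-mono v v′ v<v′ =
      from (iff _ _) (subst₂ F._<_ (sym (inverseʳ σ)) (sym (inverseʳ σ)) v<v′)
    values-σ : ∀ j → values (σ ⟨$⟩ʳ j) ≡ τ ⟨$⟩ʳ e j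
    values-σ j = cong (λ z → τ ⟨$⟩ʳ e z) (inverseˡ σ)

    module _ (j : Fin (suc m)) where
      X = toℕ (e j)
      Y = toℕ (τ ⟨$⟩ʳ e j)
      p = toℕ j
      q = toℕ (σ ⟨$⟩ʳ j)

      p≤X : p ≤ X
      p≤X = index≤ mono j
      X≤i+p : X ≤ i + p
      X≤i+p = ≤-index+ mono j
      q≤Y : q ≤ Y
      q≤Y = subst (λ v → q ≤ toℕ v) (values-σ j) (index≤ {e = values} values-mono (σ ⟨$⟩ʳ j))
      Y≤i+q : Y ≤ i + q
      Y≤i+q = subst (λ v → toℕ v ≤ i + q) (values-σ j) (≤-index+ {e = values} values-mono (σ ⟨$⟩ʳ j))

      within : ∀ {A B} → LinkedUp i A B → A < B → A ≤ X → X ≤ B → A ≤ Y → Y ≤ B → L q ≡ L p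
      within up A<B A≤X X≤B A≤Y Y≤B = trans
        (linkedUp-const up A<B (ℕ.≤-trans A≤Y Y≤i+q) (ℕ.≤-trans q≤Y Y≤B))
        (sym (linkedUp-const up A<B (ℕ.≤-trans A≤X X≤i+p) (ℕ.≤-trans p≤X X≤B)))

      within-fixed : ∀ {A B} → LinkedUp i A B → A < X → X < B → X ≡ Y → L q ≡ L p
      within-fixed {A} {B} up A<X X<B X≡Y = within up (ℕ.<-trans A<X X<B) (ℕ.<⇒≤ A<X) (ℕ.<⇒≤ X<B)
        (subst (A ≤_) X≡Y (ℕ.<⇒≤ A<X)) (subst (_≤ B) X≡Y (ℕ.<⇒≤ X<B))

      sameLabel : L q ≡ L p
      sameLabel with ℕ.<-cmp X Y
      ... | tri< X<Y _ _ =
              within (proj₁ (pres (e j))) X<Y ℕ.≤-refl (ℕ.<⇒≤ X<Y) (ℕ.<⇒≤ X<Y) ℕ.≤-refl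
      ... | tri> _ _ Y<X =
              within (proj₂ (pres (e j))) Y<X (ℕ.<⇒≤ Y<X) ℕ.≤-refl ℕ.≤-refl (ℕ.<⇒≤ Y<X)
      ... | tri≈ _ X≡Y _ with j F.≟ σ ⟨$⟩ʳ j
      ...   | yes fixed = cong (L ∘ toℕ) (sym fixed)
      ...   | no moved with moved⇒inversion σ moved
      ...     | z , inj₁ (z<j , σj<σz) = within-fixed (proj₁ (pres (e z))) (mono z j z<j)
                  (subst (_< toℕ (τ ⟨$⟩ʳ e z)) (sym X≡Y) (from (iff j z) σj<σz)) X≡Y
      ...     | z , inj₂ (j<z , σz<σj) = within-fixed (proj₂ (pres (e z)))
                  (subst (toℕ (τ ⟨$⟩ʳ e z) <_) (sym X≡Y) (from (iff z j) σz<σj)) (mono j z j<z) X≡Y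

  -- Symmetric labellings and the group generated with the reversal.

  module Symmetric (ℓ-sym : ∀ j → ℓ (opposite j) ≡ ℓ j) where

    L-mirror : ∀ k → L (m ∸ k) ≡ L k
    L-mirror k = trans (cong ℓ (clamp-opposite m k)) (ℓ-sym (clamp m k))

    -- Under k + k′ + 1 = i + m, the reflection of j to m - j exchanges the windows [k - i, k + 1]
    -- and [k′ - i, k′ + 1].
    link-mirror : ∀ {i k k′} → suc (k + k′) ≡ i + m → Link i k → Link i k′
    link-mirror {i} {k} {k′} eq link j k′≤ j≤ = trans (transfer j k′≤ j≤)
      (sym (transfer k′ (ℕ.m≤n+m k′ i) (ℕ.n≤1+n k′)))
      where
      open ℕ.≤-Reasoning
      transfer : ∀ j → k′ ≤ i + j → j ≤ suc k′ → L j ≡ L k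
      transfer j k′≤ j≤ = trans (sym (L-mirror j)) (link (m ∸ j) low high)
        where
        low : k ≤ i + (m ∸ j)
        low = ℕ.+-cancelʳ-≤ (suc k′) k _ (begin
          k + suc k′            ≡⟨ trans (ℕ.+-suc k k′) eq ⟩
          i + m                 ≤⟨ ℕ.+-monoʳ-≤ i (ℕ.m≤n+m∸n m j) ⟩
          i + (j + (m ∸ j))     ≡⟨ cong (i +_) (ℕ.+-comm j _) ⟩
          i + ((m ∸ j) + j)     ≡⟨ sym (ℕ.+-assoc i _ j) ⟩
          i + (m ∸ j) + j       ≤⟨ ℕ.+-monoʳ-≤ _ j≤ ⟩
          i + (m ∸ j) + suc k′  ∎)
        high : m ∸ j ≤ suc k
        high = ℕ.m≤n+o⇒m∸n≤o m j (ℕ.+-cancelˡ-≤ i m _ (begin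
          i + m            ≡⟨ sym eq ⟩
          suc (k + k′)     ≤⟨ s≤s (ℕ.+-monoʳ-≤ k k′≤) ⟩
          suc k + (i + j)  ≡⟨ ℕ.+-comm (suc k) _ ⟩
          i + j + suc k    ≡⟨ ℕ.+-assoc i j _ ⟩
          i + (j + suc k)  ∎))

    linkedUp-mirror : ∀ {i X Y} → LinkedUp i X Y →
                      LinkedUp i (i + m ∸ Y) (i + m ∸ X)
    linkedUp-mirror {i} {X} {Y} up k t∸Y≤k k<t∸X =
      link-mirror (trans (cong suc (ℕ.+-comm k′ k)) (ℕ.m+[n∸m]≡n k<t)) (up k′ X≤k′ k′<Y)
      where
      t = i + m
      k<t = ℕ.<-≤-trans k<t∸X (ℕ.m∸n≤m t X)
      k′ = t ∸ suc k
      X≤k′ : X ≤ k′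
      X≤k′ = ℕ.m+n≤o⇒m≤o∸n X (subst (_≤ t) (ℕ.+-comm (suc k) X) (ℕ.m≤o∸n⇒m+n≤o (suc k) X≤t k<t∸X))
        where X≤t = ℕ.<⇒≤ (ℕ.m∸n≢0⇒n<m (λ eq → ℕ.n≮0 (subst (k <_) eq k<t∸X)))
      k′<Y : k′ < Y
      k′<Y = ℕ.+-cancelʳ-≤ k (suc k′) Y (begin
        suc k′ + k         ≡⟨ sym (ℕ.+-suc k′ k) ⟩
        k′ + suc k         ≡⟨ ℕ.m∸n+n≡m k<t ⟩
        t                  ≤⟨ ℕ.m≤n+m∸n t Y ⟩
        Y + (t ∸ Y)        ≤⟨ ℕ.+-monoʳ-≤ Y t∸Y≤k ⟩
        Y + k              ∎)
        where open ℕ.≤-Reasoning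

    linked-mirror : ∀ {i} {x y : Fin (suc (i + m))} → Linked i x y →
                    Linked i (opposite x) (opposite y)
    linked-mirror {i} {x} {y} (up , down) =
      subst₂ (LinkedUp i) (sym (F.opposite-prop x)) (sym (F.opposite-prop y)) (linkedUp-mirror down) ,
      subst₂ (LinkedUp i) (sym (F.opposite-prop y)) (sym (F.opposite-prop x)) (linkedUp-mirror up)

    linked-swap : ∀ {i} {x y : Fin (suc (i + m))} → Linked i x (opposite y) → Linked i (opposite x) y
    linked-swap {i} {x} {y} r =
      subst (Linked i (opposite x)) (F.opposite-involutive y) (linked-mirror {i} {x} {opposite y} r)

    Normal : ∀ i → Permutation′ (suc (i + m)) → Set
    Normal i τ = Preserves i τ ⊎ Preserves i (τ ∘ₚ reverse)

    -- `Normal` is the union of the block-preserving subgroup and its coset by δ. As δ respects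
    -- links, it normalises the subgroup, so the union is closed under products and inverses.
    gen⇒normal : ∀ i {τ} → Gen (SΠ (iter (suc i) (labelRel ℓ))) reverse τ → Normal (suc i) τ
    gen⇒normal i (base {π} s) = inj₁ (to (iter-SΠ⇔preserves i π) s)
    gen⇒normal i gen = inj₂ λ x →
      subst (Linked (suc i) x) (sym (F.opposite-involutive x)) (linked-refl x)
    gen⇒normal i one = inj₁ linked-refl
    gen⇒normal i (mul {π} {ρ} g h) with gen⇒normal i g | gen⇒normal i h
    ... | inj₁ p | inj₁ q = inj₁ λ x →
          linked-trans {x = x} {π ⟨$⟩ʳ x} {ρ ⟨$⟩ʳ (π ⟨$⟩ʳ x)} (p x) (q (π ⟨$⟩ʳ x))
    ... | inj₁ p | inj₂ q = inj₂ λ x →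
          linked-trans {x = x} {π ⟨$⟩ʳ x} {opposite (ρ ⟨$⟩ʳ (π ⟨$⟩ʳ x))} (p x) (q (π ⟨$⟩ʳ x))
    ... | inj₂ p | inj₁ q = inj₂ λ x →
          linked-trans {x = x} {opposite (π ⟨$⟩ʳ x)} {opposite (ρ ⟨$⟩ʳ (π ⟨$⟩ʳ x))} (p x)
            (linked-mirror {suc i} {π ⟨$⟩ʳ x} {ρ ⟨$⟩ʳ (π ⟨$⟩ʳ x)} (q (π ⟨$⟩ʳ x)))
    ... | inj₂ p | inj₂ q = inj₁ λ x →
          linked-trans {x = x} {opposite (π ⟨$⟩ʳ x)} {ρ ⟨$⟩ʳ (π ⟨$⟩ʳ x)} (p x)
            (linked-swap {suc i} {π ⟨$⟩ʳ x} {ρ ⟨$⟩ʳ (π ⟨$⟩ʳ x)} (q (π ⟨$⟩ʳ x)))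
    gen⇒normal i (inv {π} g) with gen⇒normal i g
    ... | inj₁ p = inj₁ λ x → linked-sym {x = π ⟨$⟩ˡ x} {x}
          (subst (Linked (suc i) (π ⟨$⟩ˡ x)) (inverseʳ π) (p (π ⟨$⟩ˡ x)))
    ... | inj₂ p = inj₂ λ x → linked-sym {x = opposite (π ⟨$⟩ˡ x)} {x}
          (linked-swap {suc i} {π ⟨$⟩ˡ x} {x}
            (subst (Linked (suc i) (π ⟨$⟩ˡ x) ∘ opposite) (inverseʳ π) (p (π ⟨$⟩ˡ x))))
    gen⇒normal i (ext {π} {ρ} π≈ρ g) with gen⇒normal i g
    ... | inj₁ p = inj₁ λ x → subst (Linked (suc i) x) (π≈ρ x) (p x)
    ... | inj₂ p = inj₂ λ x → subst (Linked (suc i) x ∘ opposite) (π≈ρ x) (p x)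

    -- In the second case the patterns of τ are the reversals of those of δτ, and the symmetry of
    -- the labels absorbs the reversal.
    normal⇒Comp : ∀ {i} (τ : Permutation′ (suc (i + m))) → Normal i τ →
                  Comp (suc (i + m)) (SΠ (labelRel ℓ)) τ
    normal⇒Comp τ (inj₁ p) = preserves⇒Comp τ p
    normal⇒Comp τ (inj₂ p) σ pat = from (label-SΠ⇔ σ) λ j → trans (sym (ℓ-sym (σ ⟨$⟩ʳ j)))
      (to (label-SΠ⇔ (σ ∘ₚ reverse))
        (preserves⇒Comp (τ ∘ₚ reverse) p (σ ∘ₚ reverse) (pattern-reverse {σ = σ} {τ} pat)) j)

  -- Constraints forced by the patterns.

  SameSide : Permutation′ N → (x z w : Fin N) → Set
  SameSide τ x z w = (τ ⟨$⟩ʳ z F.< τ ⟨$⟩ʳ x × τ ⟨$⟩ʳ w F.< τ ⟨$⟩ʳ x) ⊎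
                     (τ ⟨$⟩ʳ x F.< τ ⟨$⟩ʳ z × τ ⟨$⟩ʳ x F.< τ ⟨$⟩ʳ w)

  sameSide-remove : (τ : Permutation′ (suc N)) (r : Fin (suc N)) {x z w : Fin N} →
                    SameSide τ (punchIn r x) (punchIn r z) (punchIn r w) →
                    SameSide (remove r τ) x z w
  sameSide-remove τ r (inj₁ (p , q)) =
    inj₁ (to (remove-iff τ r _ _) p , to (remove-iff τ r _ _) q)
  sameSide-remove τ r (inj₂ (p , q)) =
    inj₂ (to (remove-iff τ r _ _) p , to (remove-iff τ r _ _) q)

  InComp : Permutation′ N → Set
  InComp τ = Comp _ (SΠ (labelRel ℓ)) τ

  InComp-remove : (τ : Permutation′ (suc N)) (r : Fin (suc N)) → InComp τ → InComp (remove r τ)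
  InComp-remove τ r comp σ pat =
    comp σ (pattern-trans {ρ = σ} {remove r τ} {τ} pat (remove-pattern τ r))

  -- Deleting z or w from τ moves the index of x but not its value. When more than one point
  -- has to be deleted, the others are chosen so that x ends up at index k or k + 1.
  sameSide⇒step : ∀ i (τ : Permutation′ (suc (suc i + m))) → InComp τ →
                  ∀ {z x w} → z F.< x → x F.< w → SameSide τ x z w →
                  ∀ {k} → toℕ x ≤ suc i + k → k < toℕ x → k < m → L k ≡ L (suc k)
  sameSide⇒step zero τ comp {z} {x} {w} z<x x<w side {k} x≤1+k k<x k<m
    with a , a↦x ← punchIn-hit (F.<⇒≢ z<x) | b , b↦x ← punchIn-hit (F.<⇒≢ x<w ∘ sym) = begin
    L k                       ≡⟨ cong L (sym a≡k) ⟩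
    L (toℕ a)                 ≡⟨ L-toℕ a ⟩
    ℓ a                       ≡⟨ sym (to (label-SΠ⇔ (remove z τ)) (comp (remove z τ) (remove-pattern τ z)) a) ⟩
    ℓ (remove z τ ⟨$⟩ʳ a)     ≡⟨ cong ℓ (sameValue side) ⟩
    ℓ (remove w τ ⟨$⟩ʳ b)     ≡⟨ to (label-SΠ⇔ (remove w τ)) (comp (remove w τ) (remove-pattern τ w)) b ⟩
    ℓ b                       ≡⟨ sym (L-toℕ b) ⟩
    L (toℕ b)                 ≡⟨ cong L b≡1+k ⟩
    L (suc k)                 ∎
    where
    open ≡-Reasoning
    x≡1+k : toℕ x ≡ suc k
    x≡1+k = ℕ.≤-antisym x≤1+k k<x
    a≡k : toℕ a ≡ k
    a≡k = ℕ.suc-injective (trans (sym (punchIn-above-≡ a↦x z<x)) x≡1+k)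
    b≡1+k : toℕ b ≡ suc k
    b≡1+k = trans (sym (punchIn-below-≡ b↦x x<w)) x≡1+k
    τa↦τx : punchIn (τ ⟨$⟩ʳ z) (remove z τ ⟨$⟩ʳ a) ≡ τ ⟨$⟩ʳ x
    τa↦τx = trans (sym (punchIn-permute τ z a)) (cong (τ ⟨$⟩ʳ_) a↦x)
    τb↦τx : punchIn (τ ⟨$⟩ʳ w) (remove w τ ⟨$⟩ʳ b) ≡ τ ⟨$⟩ʳ x
    τb↦τx = trans (sym (punchIn-permute τ w b)) (cong (τ ⟨$⟩ʳ_) b↦x)
    -- Either both deleted values lie below that of x and lower it by one, or both lie above and
    -- leave it alone.
    sameValue : SameSide τ x z w → remove z τ ⟨$⟩ʳ a ≡ remove w τ ⟨$⟩ʳ b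
    sameValue (inj₁ (z↓ , w↓)) = F.toℕ-injective (ℕ.suc-injective
      (trans (sym (punchIn-above-≡ τa↦τx z↓)) (punchIn-above-≡ τb↦τx w↓)))
    sameValue (inj₂ (z↑ , w↑)) = F.toℕ-injective
      (trans (sym (punchIn-below-≡ τa↦τx z↑)) (punchIn-below-≡ τb↦τx w↑))
  sameSide⇒step (suc i) τ comp {z} {x} {w} z<x x<w side {k} x≤ k<x k<m
    with toℕ x ℕ.≤? suc i + k
  -- There is slack in the bound on x, so its index is kept by deleting a position above it other
  -- than w: x + 1, or x + 2 if w is x + 1. Both exist because k < m.
  ... | yes x≤′ = deleteAbove (w F.≟ r₁)
    where
    2+x≤ : 2 + toℕ x ≤ suc (suc i) + m
    2+x≤ = s≤s (ℕ.≤-trans (s≤s x≤′)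
      (subst (_≤ suc i + m) (ℕ.+-suc (suc i) k) (ℕ.+-monoʳ-≤ (suc i) k<m)))
    r₁ r₂ : Fin (suc (suc (suc i) + m))
    r₁ = fromℕ< (ℕ.m≤n⇒m≤1+n 2+x≤)
    r₂ = fromℕ< (s≤s 2+x≤)
    r₁≡ : toℕ r₁ ≡ suc (toℕ x)
    r₁≡ = F.toℕ-fromℕ< (ℕ.m≤n⇒m≤1+n 2+x≤)
    r₂≡ : toℕ r₂ ≡ 2 + toℕ x
    r₂≡ = F.toℕ-fromℕ< (s≤s 2+x≤)
    delete : ∀ r → x F.< r → r ≢ w → L k ≡ L (suc k)
    delete r x<r r≢w with z′ , refl ← punchIn-hit (F.<⇒≢ (F.<-trans z<x x<r) ∘ sym)
                        | x′ , refl ← punchIn-hit (F.<⇒≢ x<r ∘ sym)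
                        | w′ , refl ← punchIn-hit r≢w =
      sameSide⇒step i (remove r τ) (InComp-remove τ r comp)
        (punchIn-cancel-< r z′ x′ z<x) (punchIn-cancel-< r x′ w′ x<w) (sameSide-remove τ r side)
        (subst (_≤ suc i + k) (punchIn-below r x′ x<r) x≤′)
        (subst (k <_) (punchIn-below r x′ x<r) k<x) k<m
    deleteAbove : Dec (w ≡ r₁) → L k ≡ L (suc k)
    deleteAbove (no  w≢r₁) = delete r₁ (ℕ.≤-reflexive (sym r₁≡)) (w≢r₁ ∘ sym)
    deleteAbove (yes w≡r₁) = delete r₂ (ℕ.≤-trans (ℕ.n≤1+n _) (ℕ.≤-reflexive (sym r₂≡)))
      λ r₂≡w → ℕ.1+n≢n (trans (sym r₂≡) (trans (cong toℕ (trans r₂≡w w≡r₁)) r₁≡))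
  -- Now x = k + i + 2 has to move down by one. Positions 0 and 1 both lie below x, and one of them
  -- differs from z.
  ... | no x≰ = deleteBelow (z F.≟ zero)
    where
    x≡ : toℕ x ≡ suc (suc i + k)
    x≡ = ℕ.≤-antisym x≤ (ℕ.≰⇒> x≰)
    delete : ∀ r → r F.< x → r ≢ z → L k ≡ L (suc k)
    delete r r<x r≢z with z′ , refl ← punchIn-hit r≢z
                        | x′ , refl ← punchIn-hit (F.<⇒≢ r<x)
                        | w′ , refl ← punchIn-hit (F.<⇒≢ (F.<-trans r<x x<w)) =
      sameSide⇒step i (remove r τ) (InComp-remove τ r comp)
        (punchIn-cancel-< r z′ x′ z<x) (punchIn-cancel-< r x′ w′ x<w) (sameSide-remove τ r side)
        (ℕ.≤-reflexive x′≡) (subst (k <_) (sym x′≡) (s≤s (ℕ.m≤n+m k i))) k<m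
      where
      x′≡ : toℕ x′ ≡ suc i + k
      x′≡ = ℕ.suc-injective (trans (sym (punchIn-above r x′ r<x)) x≡)
    deleteBelow : Dec (z ≡ zero) → L k ≡ L (suc k)
    deleteBelow (no  z≢0) = delete zero (subst (0 <_) (sym x≡) z<s) (z≢0 ∘ sym)
    deleteBelow (yes z≡0) = delete (suc zero) (subst (1 <_) (sym x≡) (s<s z<s))
      λ 1≡z → F.0≢1+n (sym (trans 1≡z z≡0))

  -- L is constant on [X - i, X].
  Settled : ℕ → ℕ → Set
  Settled i X = ∀ {k} → X ≤ i + k → k < X → L k ≡ L (suc k)

  settled-const : ∀ {i X} → Settled i X → ∀ d {j} → d + j ≡ X → X ≤ i + j → L j ≡ L X
  settled-const settled zero    eq _ = cong L eq
  settled-const {i} {X} settled (suc d) {j} eq X≤ = trans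
    (settled X≤ (subst (j <_) eq (s≤s (ℕ.m≤n+m j d))))
    (settled-const {i} {X} settled d (trans (ℕ.+-suc d j) eq)
      (ℕ.≤-trans X≤ (ℕ.+-monoʳ-≤ i (ℕ.n≤1+n j))))

  -- The hypothesis at k covers the window up to k; the one at k + 1 adds the last step.
  settled⇒link : ∀ {i k} → Settled (suc i) k → Settled (suc i) (suc k) → Link (suc i) k
  settled⇒link {i} {k} sₖ sₖ₊₁ j k≤ j≤ with ℕ.m≤n⇒m<n∨m≡n j≤
  ... | inj₁ (s≤s j≤k) = settled-const {suc i} {k} sₖ (k ∸ j) (ℕ.m∸n+n≡m j≤k) k≤
  ... | inj₂ refl      = sym (sₖ₊₁ (s≤s (ℕ.m≤n+m k i)) ℕ.≤-refl)

  -- If u and v lie on different sides of x in position, their values lie on the same side.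
  -- Otherwise any point across x has its value on the same side as one of them.
  mixed⇒settled : ∀ i (τ : Permutation′ (suc (suc i + m))) → InComp τ → ∀ {x u v} →
                  Inversion τ x u → NonInversion τ x v → Settled (suc i) (toℕ x)
  mixed⇒settled i τ comp {x} {u} {v} inversion nonInversion {k} x≤ k<x with k ℕ.<? m
  ... | no k≮m = L-top (ℕ.≮⇒≥ k≮m) (ℕ.m≤n⇒m≤1+n (ℕ.≮⇒≥ k≮m))
  ... | yes k<m = choose inversion nonInversion
    where
    step : ∀ {z w} → z F.< x → x F.< w → SameSide τ x z w → L k ≡ L (suc k)
    step z<x x<w side = sameSide⇒step i τ comp z<x x<w side x≤ k<x k<m
    0<x : F.zero {n = suc i + m} F.< x
    0<x = ℕ.≤-<-trans z≤n k<x
    -- The bound k < m keeps x off the last position, just as k < x keeps it off the first; so both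
    -- neighbouring sides are inhabited.
    1+x<N : suc (toℕ x) < suc (suc i + m)
    1+x<N = s≤s (ℕ.≤-<-trans x≤ (ℕ.+-monoʳ-< (suc i) k<m))
    next = fromℕ< 1+x<N
    x<next : x F.< next
    x<next = ℕ.≤-reflexive (sym (F.toℕ-fromℕ< 1+x<N))
    choose : Inversion τ x u → NonInversion τ x v → L k ≡ L (suc k)
    choose (inj₁ (u<x , u↑)) (inj₂ (x<v , v↑)) = step u<x x<v (inj₂ (u↑ , v↑))
    choose (inj₂ (x<u , u↓)) (inj₁ (v<x , v↓)) = step v<x x<u (inj₁ (v↓ , u↓))
    choose (inj₁ (u<x , u↑)) (inj₁ (v<x , v↓)) with inversion-or-non τ (F.<⇒≢ x<next)
    ... | inj₁ (inj₁ (n<x , _))  = contradiction n<x (ℕ.<-asym x<next)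
    ... | inj₁ (inj₂ (x<n , n↓)) = step v<x x<n (inj₁ (v↓ , n↓))
    ... | inj₂ (inj₁ (n<x , _))  = contradiction n<x (ℕ.<-asym x<next)
    ... | inj₂ (inj₂ (x<n , n↑)) = step u<x x<n (inj₂ (u↑ , n↑))
    choose (inj₂ (x<u , u↓)) (inj₂ (x<v , v↑)) with inversion-or-non τ (F.<⇒≢ 0<x ∘ sym)
    ... | inj₁ (inj₁ (_ , 0↑)) = step 0<x x<v (inj₂ (0↑ , v↑))
    ... | inj₂ (inj₁ (_ , 0↓)) = step 0<x x<u (inj₁ (0↓ , u↓))

  -- Every position between x and π x is part of an inversion: either with x itself,
  -- or because it is moved further than x.
  inversions-settled⇒preserves : ∀ {i} (π : Permutation′ N) →
    (∀ {x z} → Inversion π x z → Settled (suc i) (toℕ x)) → Preserves (suc i) π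
  inversions-settled⇒preserves {N} {i} π settled x = up , down
    where
    y = π ⟨$⟩ʳ x
    moved-settled : ∀ {z} → z ≢ π ⟨$⟩ʳ z → Settled (suc i) (toℕ z)
    moved-settled moved = settled (proj₂ (moved⇒inversion π moved))

    above : ∀ z → x F.< y → x F.≤ z → z F.≤ y → Settled (suc i) (toℕ z)
    above z x<y x≤z z≤y with F.<-cmp x z | F.<-cmp (π ⟨$⟩ʳ z) y
    ... | tri≈ _ refl _ | _             = moved-settled (F.<⇒≢ x<y)
    ... | tri> _ _ z<x  | _             = contradiction x≤z (ℕ.<⇒≱ z<x)
    ... | tri< x<z _ _  | tri< πz<y _ _ = settled (inj₁ (x<z , πz<y))
    ... | tri< _ x≢z _  | tri≈ _ eq _   = contradiction (sym (perm-injective π eq)) x≢z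
    ... | tri< _ _ _    | tri> _ _ y<πz = moved-settled (F.<⇒≢ (ℕ.≤-<-trans z≤y y<πz))

    below : ∀ z → y F.< x → y F.≤ z → z F.≤ x → Settled (suc i) (toℕ z)
    below z y<x y≤z z≤x with F.<-cmp z x | F.<-cmp (π ⟨$⟩ʳ z) y
    ... | tri≈ _ refl _ | _             = moved-settled (F.<⇒≢ y<x ∘ sym)
    ... | tri> _ _ x<z  | _             = contradiction z≤x (ℕ.<⇒≱ x<z)
    ... | tri< z<x _ _  | tri> _ _ y<πz = settled (inj₂ (z<x , y<πz))
    ... | tri< _ z≢x _  | tri≈ _ eq _   = contradiction (perm-injective π eq) z≢x
    ... | tri< _ _ _    | tri< πz<y _ _ = moved-settled (F.<⇒≢ (ℕ.<-≤-trans πz<y y≤z) ∘ sym)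

    atℕ : ∀ {lo hi : Fin N} → (∀ z → lo F.≤ z → z F.≤ hi → Settled (suc i) (toℕ z)) →
          ∀ k → toℕ lo ≤ k → k ≤ toℕ hi → Settled (suc i) k
    atℕ {lo} {hi} s k lo≤k k≤hi = subst (Settled (suc i)) eq
      (s z (subst (toℕ lo ≤_) (sym eq) lo≤k) (subst (_≤ toℕ hi) (sym eq) k≤hi))
      where
      k<N = ℕ.≤-<-trans k≤hi (F.toℕ<n hi)
      z = fromℕ< k<N
      eq = F.toℕ-fromℕ< k<N

    links : ∀ {lo hi : Fin N} → (∀ z → lo F.≤ z → z F.≤ hi → Settled (suc i) (toℕ z)) →
            LinkedUp (suc i) (toℕ lo) (toℕ hi)
    links {lo} {hi} s k lo≤k k<hi = settled⇒link
      (atℕ {lo} {hi} s k lo≤k (ℕ.<⇒≤ k<hi)) (atℕ {lo} {hi} s (suc k) (ℕ.m≤n⇒m≤1+n lo≤k) k<hi)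

    up : LinkedUp (suc i) (toℕ x) (toℕ y)
    up k x≤k k<y = links {x} {y} (λ z → above z (ℕ.≤-<-trans x≤k k<y)) k x≤k k<y
    down : LinkedUp (suc i) (toℕ y) (toℕ x)
    down k y≤k k<x = links {y} {x} (λ z → below z (ℕ.≤-<-trans y≤k k<x)) k y≤k k<x

  -- If some point is inverted with all others, then every other point that is also part of a
  -- non-inversion is settled, so the reversal of τ has the required form; any pattern of τ
  -- together with its reversal then forces δ into S_Π.
  Comp⇒preserves : ∀ i (τ : Permutation′ (suc (suc i + m))) → InComp τ →
    Preserves (suc i) τ ⊎ (SΠ (labelRel ℓ) reverse × Preserves (suc i) (τ ∘ₚ reverse))
  Comp⇒preserves i τ comp with F.all? (λ x → F.any? (nonInversion? τ x))
  ... | yes allNon = inj₁ (inversions-settled⇒preserves τ λ {x} inversion →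
          mixed⇒settled i τ comp inversion (proj₂ (allNon x)))
  ... | no ¬allNon with x₀ , none ← F.¬∀⟶∃¬ _ _ (λ x → F.any? (nonInversion? τ x)) ¬allNon =
    inj₂ (from (label-SΠ⇔ reverse) reverse-label , pres)
    where
    inverted : ∀ {x} → x₀ ≢ x → Inversion τ x x₀
    inverted {x} x₀≢x with inversion-or-non τ x₀≢x
    ... | inj₁ inversion    = inversion-sym τ inversion
    ... | inj₂ nonInversion = contradiction (x , nonInversion) none

    pres : Preserves (suc i) (τ ∘ₚ reverse)
    pres = inversions-settled⇒preserves (τ ∘ₚ reverse) λ {x} {z} inv →
      let nonInversion = reverse-inversion τ inv
      -- The point x is not x₀, because it has a non-inversion.
      in mixed⇒settled i τ comp (inverted λ { refl → none (z , nonInversion) }) nonInversion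

    reverse-label : ∀ j → ℓ (opposite j) ≡ ℓ j
    reverse-label j with σ , pat ← ∃-pattern (suc i) τ = begin
      ℓ (opposite j)                        ≡⟨ cong (ℓ ∘ opposite) (sym (inverseʳ σ)) ⟩
      ℓ (opposite (σ ⟨$⟩ʳ (σ ⟨$⟩ˡ j)))      ≡⟨ to (label-SΠ⇔ (σ ∘ₚ reverse)) reversed (σ ⟨$⟩ˡ j) ⟩
      ℓ (σ ⟨$⟩ˡ j)                          ≡⟨ sym (to (label-SΠ⇔ σ) (comp σ pat) (σ ⟨$⟩ˡ j)) ⟩
      ℓ (σ ⟨$⟩ʳ (σ ⟨$⟩ˡ j))                 ≡⟨ cong ℓ (inverseʳ σ) ⟩
      ℓ j                                   ∎
      where
      open ≡-Reasoning
      reversed : SΠ (labelRel ℓ) (σ ∘ₚ reverse)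
      reversed = preserves⇒Comp (τ ∘ₚ reverse) pres (σ ∘ₚ reverse) (pattern-reverse {σ = σ} {τ} pat)

theorem4p9 : (m : ℕ) (ℓ : Fin (suc m) → ℕ) (i : ℕ) → 1 ≤ i →
    (¬ SΠ (labelRel ℓ) reverse →
    (τ : Permutation′ (suc (i + m))) →
    Comp (suc (i + m)) (SΠ (labelRel ℓ)) τ ⇔ SΠ (iter i (labelRel ℓ)) τ)
    ×
    (SΠ (labelRel ℓ) reverse →
    (τ : Permutation′ (suc (i + m))) →
    Comp (suc (i + m)) (SΠ (labelRel ℓ)) τ ⇔ Gen (SΠ (iter i (labelRel ℓ))) reverse τ)
theorem4p9 m ℓ (suc i) _ = withoutReverse , withReverse
  where
  open Labelled ℓ
  S⁽ⁱ⁾ : Permutation′ (suc (suc i + m)) → Set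
  S⁽ⁱ⁾ = SΠ (iter (suc i) (labelRel ℓ))

  withoutReverse : ¬ SΠ (labelRel ℓ) reverse → ∀ τ → InComp τ ⇔ S⁽ⁱ⁾ τ
  withoutReverse ¬rev τ = mk⇔
    (λ comp → from (iter-SΠ⇔preserves i τ)
      ([ id , (λ (rev , _) → contradiction rev ¬rev) ]′ (Comp⇒preserves i τ comp)))
    (preserves⇒Comp τ ∘ to (iter-SΠ⇔preserves i τ))

  withReverse : SΠ (labelRel ℓ) reverse → ∀ τ → InComp τ ⇔ Gen S⁽ⁱ⁾ reverse τ
  withReverse rev τ = mk⇔
    (λ comp → [ base ∘ from (iter-SΠ⇔preserves i τ)
              -- Here τ is written as δ(δτ), with δτ preserving the blocks.
              , (λ (_ , pres) → ext {π = (τ ∘ₚ reverse) ∘ₚ reverse} (λ x → F.opposite-involutive (τ ⟨$⟩ʳ x))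
                  (mul {π = τ ∘ₚ reverse} (base (from (iter-SΠ⇔preserves i (τ ∘ₚ reverse)) pres)) gen)) ]′
              (Comp⇒preserves i τ comp))
    (normal⇒Comp τ ∘ gen⇒normal i)
    where open Symmetric (to (label-SΠ⇔ reverse) rev)
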